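{- Let $G=(V,E)$ be a graph with maximum degree $\Delta$, let $n=|V|$, and let $k$ be a positive integer. Let $c:V\to[k+1]$ be a legal $(k+1)$-coloring of $G$ such that $|V_{c,k+1}|\le |V_{c,i}|$ holds for every $i\in[k+1]$. Then every $c'\in\mathcal{R}(c)$ satisfies $$\rho_k(c')\le \frac{n\Delta}{k+1}.$$
   Context: Graphs are finite, simple and undirected; an edge $\{u,v\}$ is written $uv$. For a positive integer $n$, $[n]=\{1,\dots,n\}$. A $k$-coloring of $G=(V,E)$ is a mapping $c:V\to[k]$ (it uses at most $k$ colors, so not every color has to be used). An edge $uv\in E$ is conflicting in $c$ if $c(u)=c(v)$; the coloring $c$ is legal if it has no conflicting edge. For a color $i$, the color class $i$ is $V_{c,i}=\{v\in V : c(v)=i\}$. The set of all $k$-colorings of $G$ (legal or not) is denoted $\mathcal{S}_k$. The penalty function $\rho_k$ on $\mathcal{S}_k$ is the number of conflicting edges: $\rho_k(c)=|\{uv\in E : c(u)=c(v)\}|$. For a legal $(k+1)$-coloring $c$, $\mathcal{R}(c)$ is the set of all $k$-colorings obtained from $c$ by changing the colors of the vertices in $V_{c,k+1}$ to colors in $[k]$ (all other vertices keeping their colors), that is, $$\mathcal{R}(c)=\{c'\in\mathcal{S}_k : \forall i\in[k],\ V_{c',i}\supseteq V_{c,i},\ V_{c',i}\setminus V_{c,i}\subseteq V_{c,k+1}\}.$$ -}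

module Defs where

open import Data.Nat using (ℕ; suc)
open import Data.Fin using (Fin; _<_; _<?_; _≟_; fromℕ; inject₁)
open import Data.Fin.Subset using (Subset; ∣_∣; _⊆_; _⊇_; _─_)
open import Data.List using (List; allFin; cartesianProduct; filter; length; map)
open import Data.List.Extrema.Nat using (max)
open import Data.Product using (_×_; _,_)
open import Data.Vec using (tabulate)
open import Relation.Binary using (Decidable; Irreflexive; Symmetric)
open import Relation.Binary.PropositionalEquality using (_≡_)
open import Relation.Nullary using (Dec; does; ¬_; _×-dec_)

record Graph (n : ℕ) : Set₁ where
  field
    Adj    : Fin n → Fin n → Set
    adj?   : Decidable Adj
    sym    : Symmetric Adj
    irrefl : Irreflexive _≡_ Adj

  neighbours : Fin n → Subset n
  neighbours v = tabulate (λ u → does (adj? v u))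

  degree : Fin n → ℕ
  degree v = ∣ neighbours v ∣

  -- Equal to 0 for the graph with no vertices.
  maxDegree : ℕ
  maxDegree = max 0 (map degree (allFin n))

  -- An undirected edge uv is listed once, as the pair with u < v.
  edges : List (Fin n × Fin n)
  edges = filter (λ (u , v) → (u <? v) ×-dec adj? u v)
                 (cartesianProduct (allFin n) (allFin n))

-- The colors 1, …, k are the elements 0, …, k - 1 of Fin k.
Coloring : ℕ → ℕ → Set
Coloring n k = Fin n → Fin k

-- The color k + 1 of a (k + 1)-coloring. A color i of [k], regarded as a
-- color of [k + 1], is inject₁ i.
lastColor : ∀ k → Fin (suc k)
lastColor = fromℕ

module _ {n k : ℕ} where

  colorClass : Coloring n k → Fin k → Subset n
  colorClass c i = tabulate (λ v → does (c v ≟ i))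

  Monochromatic : Coloring n k → Fin n × Fin n → Set
  Monochromatic c (u , v) = c u ≡ c v

  monochromatic? : (c : Coloring n k) (e : Fin n × Fin n) → Dec (Monochromatic c e)
  monochromatic? c (u , v) = c u ≟ c v

  Legal : Graph n → Coloring n k → Set
  Legal G c = ∀ u v → Graph.Adj G u v → ¬ Monochromatic c (u , v)

  ρ : Graph n → Coloring n k → ℕ
  ρ G c = length (filter (monochromatic? c) (Graph.edges G))

ℛ : ∀ {n k} → Coloring n (suc k) → Coloring n k → Set
ℛ {k = k} c c′ = ∀ (i : Fin k) →
  colorClass c′ i ⊇ colorClass c (inject₁ i) ×
  (colorClass c′ i ─ colorClass c (inject₁ i)) ⊆ colorClass c (lastColor k)

{-# OPTIONS --safe #-}

-- A conflicting edge of c′ has an endpoint in the last color class L of c: the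
-- vertices outside L keep their colors and c is legal. Hence ρ c′ ≤ ∣ L ∣ * Δ,
-- and (k + 1) * ∣ L ∣ ≤ n since L is a smallest of the k + 1 classes.
module Submission where

open import Defs
open import Data.Nat using (ℕ; suc; NonZero; _≤_; _*_)
open import Data.Fin using (Fin)
open import Data.Fin.Subset using (∣_∣)
open import Data.Integer using (+_)
open import Data.Rational using (_/_) renaming (_≤_ to _≤ℚ_)

import Algebra.Properties.Semiring.Sum
open import Data.Bool using (true; false; if_then_else_)
open import Data.Fin using (zero; suc; fromℕ; inject₁; _<_; _<?_; _≟_)
open import Data.Fin.Properties using (<-asym)
open import Data.Fin.Relation.Unary.Top using (view; ‵fromℕ; ‵inject₁)
open import Data.Fin.Subset using (_∈_)
open import Data.Integer using (+≤+)
import Data.Integer as ℤ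
import Data.Integer.Properties as ℤ
open import Data.List using ([]; _∷_; _++_; allFin; cartesianProduct; filter; length; map; tabulate)
open import Data.List.Extrema.Nat using (xs≤max)
open import Data.List.Membership.Propositional.Properties using (∈-allFin; ∈-map⁺)
open import Data.List.Properties using (filter-++; length-++; map-tabulate)
import Data.List.Relation.Unary.All as All
open import Data.Nat using (_+_; z≤n; s≤s)
open import Data.Nat.Properties hiding (_≟_; _<?_; <-asym)
open import Data.Product using (_×_; _,_; ∃; proj₁; proj₂; uncurry)
open import Data.Rational.Properties using (toℚᵘ-cancel-≤; toℚᵘ-fromℚᵘ)
open import Data.Rational.Unnormalised using (mkℚᵘ; *≤*) renaming (_≤_ to _≤ᵘ_)
import Data.Rational.Unnormalised.Properties as ℚᵘ
open import Data.Sum using (_⊎_; inj₁; inj₂)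
import Data.Vec as Vec
open import Data.Vec.Properties using (lookup∘tabulate; lookup⇒[]=; []=⇒lookup)
open import Function using (_∘_; id)
open import Level using (Level)
open import Relation.Binary.PropositionalEquality
  using (_≡_; refl; sym; trans; cong; cong₂; module ≡-Reasoning)
open import Relation.Nullary using (Dec; yes; no; ¬_; does; contradiction; _×-dec_)
open import Relation.Nullary.Decidable using (dec-true)
open import Relation.Unary using (Pred; Decidable)

open Algebra.Properties.Semiring.Sum +-*-semiring
  using (sum; sum-syntax; sum-cong-≗; ∑-distrib-+; ∑-comm;
         *-distribˡ-sum; *-distribʳ-sum)

private
  variable
    a p q : Level
    A B C D : Set a
    n k : ℕ

-- Finite sums and indicators.

∑-mono-≤ : {f g : Fin n → ℕ} → (∀ i → f i ≤ g i) → sum f ≤ sum g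
∑-mono-≤ {n = ℕ.zero} f≤g = z≤n
∑-mono-≤ {n = suc _}  f≤g = +-mono-≤ (f≤g zero) (∑-mono-≤ (f≤g ∘ suc))

∑-const : ∀ n m → ∑[ _ < n ] m ≡ n * m
∑-const ℕ.zero  m = refl
∑-const (suc n) m = cong₂ _+_ refl (∑-const n m)

-- Going through `does` lets indicators of compound decisions reduce without a proof of `A`, and
-- matches the Boolean tests in `Vec.tabulate` and `filter`.
𝟙 : Dec A → ℕ
𝟙 a? = if does a? then 1 else 0

𝟙-exclusive : (a? : Dec A) (b? : Dec B) (c? : Dec C) →
  (A → ¬ B) → (A → C) → (B → C) → 𝟙 a? + 𝟙 b? ≤ 𝟙 c?
𝟙-exclusive (yes a) (yes b) c? ¬ab _  _   = contradiction b (¬ab a)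
𝟙-exclusive (yes a) (no _)  c? _   ac _  rewrite dec-true c? (ac a) = ≤-refl
𝟙-exclusive (no _)  (yes b) c? _   _  bc rewrite dec-true c? (bc b) = ≤-refl
𝟙-exclusive (no _)  (no _)  c? _   _  _   = z≤n

-- `B` serves only to choose between `C` and `D` and is then dropped; `A` stays as a factor, so that
-- sums over all pairs still see only edges.
𝟙-cover : (a? : Dec A) (b? : Dec B) (c? : Dec C) (d? : Dec D) → (A → B → C ⊎ D) →
  𝟙 (a? ×-dec b?) ≤ 𝟙 c? * 𝟙 a? + 𝟙 d? * 𝟙 a?
𝟙-cover (no _)  _       _  _  _ = z≤n
𝟙-cover (yes _) (no _)  _  _  _ = z≤n
𝟙-cover (yes a) (yes b) c? d? cover with cover a b
... | inj₁ c rewrite dec-true c? c = s≤s z≤n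
-- Here `c?` is undecided, so its whole summand is absorbed by the underscore.
... | inj₂ d rewrite dec-true d? d = m≤n+m 1 _

-- Cardinalities and list lengths as sums of indicators.

∣tabulate∣ : {P : Pred (Fin n) p} (P? : Decidable P) →
  ∣ Vec.tabulate (does ∘ P?) ∣ ≡ ∑[ i < n ] 𝟙 (P? i)
∣tabulate∣ {n = ℕ.zero} P? = refl
∣tabulate∣ {n = suc _}  P? with does (P? zero)
... | true  = cong suc (∣tabulate∣ (P? ∘ suc))
... | false = ∣tabulate∣ (P? ∘ suc)

length-filter-tabulate : {P : Pred A p} (P? : Decidable P) (f : Fin n → A) →
  length (filter P? (tabulate f)) ≡ ∑[ i < n ] 𝟙 (P? (f i))
length-filter-tabulate {n = ℕ.zero} P? f = refl
length-filter-tabulate {n = suc _}  P? f with does (P? (f zero))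
... | true  = cong suc (length-filter-tabulate P? (f ∘ suc))
... | false = length-filter-tabulate P? (f ∘ suc)

-- General in `f` because the induction passes to `f ∘ suc`; with `f` and `g` equal to `id` the
-- lists are those of `allFin`.
length-filter-cartesianProduct : ∀ {m} {P : Pred (A × B) p} (P? : Decidable P)
  (f : Fin m → A) (g : Fin n → B) →
  length (filter P? (cartesianProduct (tabulate f) (tabulate g)))
    ≡ ∑[ i < m ] ∑[ j < n ] 𝟙 (P? (f i , g j))
length-filter-cartesianProduct {m = ℕ.zero} P? f g = refl
length-filter-cartesianProduct {n = n} {m = suc m} P? f g = begin
  length (filter P? (map (f zero ,_) (tabulate g) ++ rest))
    ≡⟨ cong (λ row → length (filter P? (row ++ rest))) (map-tabulate g (f zero ,_)) ⟩
  length (filter P? (row₀ ++ rest))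
    ≡⟨ cong length (filter-++ P? row₀ rest) ⟩
  length (filter P? row₀ ++ filter P? rest)
    ≡⟨ length-++ (filter P? row₀) ⟩
  length (filter P? row₀) + length (filter P? rest)
    ≡⟨ cong₂ _+_ (length-filter-tabulate P? (λ j → f zero , g j))
                 (length-filter-cartesianProduct P? (f ∘ suc) g) ⟩
  ∑[ i < suc m ] ∑[ j < n ] 𝟙 (P? (f i , g j)) ∎
  where
  open ≡-Reasoning
  row₀ = tabulate (λ j → f zero , g j)
  rest = cartesianProduct (tabulate (f ∘ suc)) (tabulate g)

-- `ρ` filters `edges`, itself a filter of all ordered pairs; one merged test turns it into a double
-- sum.
length-filter-filter : {P : Pred A p} {Q : Pred A q} (P? : Decidable P) (Q? : Decidable Q) →
  ∀ xs → length (filter Q? (filter P? xs)) ≡ length (filter (λ x → P? x ×-dec Q? x) xs)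
length-filter-filter P? Q? [] = refl
length-filter-filter P? Q? (x ∷ xs) with does (P? x)
... | false = length-filter-filter P? Q? xs
... | true with does (Q? x)
...   | true  = cong suc (length-filter-filter P? Q? xs)
...   | false = length-filter-filter P? Q? xs

-- `does (suc j ≟ suc i)` reduces to `does (j ≟ i)`, so the successor case is the induction
-- hypothesis as it stands.
∑-𝟙-≟ : (j : Fin n) → ∑[ i < n ] 𝟙 (j ≟ i) ≡ 1
∑-𝟙-≟ {n = suc n} zero    = cong suc (trans (∑-const n 0) (*-zeroʳ n))
∑-𝟙-≟ {n = suc _} (suc j) = ∑-𝟙-≟ j

-- Edges covered by a set of vertices.

module _ (G : Graph n) where
  open Graph G hiding (sym)

  degree≤maxDegree : ∀ v → degree v ≤ maxDegree
  degree≤maxDegree v = All.lookup (xs≤max 0 _) (∈-map⁺ degree (∈-allFin v))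

  private
    edge? : ∀ u v → Dec (u < v × Adj u v)
    edge? u v = (u <? v) ×-dec adj? u v

  -- `u < v` and `v < u` exclude each other, so an edge is counted in one orientation only. This
  -- makes the charge to a vertex its degree and not twice that.
  edge+edge≤adj : ∀ u v → 𝟙 (edge? u v) + 𝟙 (edge? v u) ≤ 𝟙 (adj? u v)
  edge+edge≤adj u v = 𝟙-exclusive (edge? u v) (edge? v u) (adj? u v)
    (λ (u<v , _) (v<u , _) → <-asym u<v v<u) proj₂ (λ (_ , vu) → Graph.sym G vu)

  module _ {P : Pred (Fin n × Fin n) p} (P? : Decidable P)
           {Q : Pred (Fin n) q} (Q? : Decidable Q)
           (cover : ∀ u v → Adj u v → P (u , v) → Q u ⊎ Q v) where

    private
      covered : ∀ u v → 𝟙 (edge? u v ×-dec P? (u , v))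
                          ≤ 𝟙 (Q? u) * 𝟙 (edge? u v) + 𝟙 (Q? v) * 𝟙 (edge? u v)
      covered u v = 𝟙-cover (edge? u v) (P? (u , v)) (Q? u) (Q? v) (λ (_ , uv) → cover u v uv)

    -- Each edge satisfying `P` is charged to its ends in the cover `Q`, and a vertex is charged at
    -- most once per incident edge, hence at most `maxDegree` times.
    length-filter-edges≤cover*maxDegree :
      length (filter P? edges) ≤ ∣ Vec.tabulate (does ∘ Q?) ∣ * maxDegree
    length-filter-edges≤cover*maxDegree = begin
      length (filter P? edges)
        ≡⟨ length-filter-filter (uncurry edge?) P? (cartesianProduct (allFin n) (allFin n)) ⟩
      length (filter (λ e → uncurry edge? e ×-dec P? e) (cartesianProduct (allFin n) (allFin n)))
        ≡⟨ length-filter-cartesianProduct (λ e → uncurry edge? e ×-dec P? e) id id ⟩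
      ∑[ u < n ] ∑[ v < n ] 𝟙 (edge? u v ×-dec P? (u , v))
        ≤⟨ ∑-mono-≤ (λ u → ∑-mono-≤ (covered u)) ⟩
      ∑[ u < n ] ∑[ v < n ] (l u * x u v + l v * x u v)
        ≡⟨ trans (sum-cong-≗ (λ u → ∑-distrib-+ (λ v → l u * x u v) (λ v → l v * x u v)))
                 (∑-distrib-+ (λ u → ∑[ v < n ] (l u * x u v)) (λ u → ∑[ v < n ] (l v * x u v))) ⟩
      ∑[ u < n ] ∑[ v < n ] (l u * x u v) + ∑[ u < n ] ∑[ v < n ] (l v * x u v)
        -- Exchanging the roles of `u` and `v` gives both double sums the factor `l u`: one collects
        -- the edges from `u` to larger vertices, the other those to smaller ones.
        ≡⟨ cong₂ _+_ refl (∑-comm (λ u v → l v * x u v)) ⟩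
      ∑[ u < n ] ∑[ v < n ] (l u * x u v) + ∑[ u < n ] ∑[ v < n ] (l u * x v u)
        ≡⟨ ∑-distrib-+ (λ u → ∑[ v < n ] (l u * x u v)) (λ u → ∑[ v < n ] (l u * x v u)) ⟨
      ∑[ u < n ] (∑[ v < n ] (l u * x u v) + ∑[ v < n ] (l u * x v u))
        ≡⟨ sum-cong-≗ (λ u → cong₂ _+_ (*-distribˡ-sum (l u) (x u))
                                       (*-distribˡ-sum (l u) (λ v → x v u))) ⟨
      ∑[ u < n ] (l u * ∑[ v < n ] x u v + l u * ∑[ v < n ] x v u)
        ≡⟨ sum-cong-≗ (λ u → trans (cong (l u *_) (∑-distrib-+ (x u) (λ v → x v u)))
                                   (*-distribˡ-+ (l u) (sum (x u)) (∑[ v < n ] x v u))) ⟨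
      ∑[ u < n ] (l u * ∑[ v < n ] (x u v + x v u))
        ≤⟨ ∑-mono-≤ (λ u → *-monoʳ-≤ (l u) (∑-mono-≤ (edge+edge≤adj u))) ⟩
      ∑[ u < n ] (l u * ∑[ v < n ] 𝟙 (adj? u v))
        ≡⟨ sum-cong-≗ (λ u → cong (l u *_) (∣tabulate∣ (adj? u))) ⟨
      ∑[ u < n ] (l u * degree u)
        ≤⟨ ∑-mono-≤ (λ u → *-monoʳ-≤ (l u) (degree≤maxDegree u)) ⟩
      ∑[ u < n ] (l u * maxDegree)
        ≡⟨ *-distribʳ-sum maxDegree l ⟨
      sum l * maxDegree
        ≡⟨ cong (_* maxDegree) (∣tabulate∣ Q?) ⟨
      ∣ Vec.tabulate (does ∘ Q?) ∣ * maxDegree ∎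
      where
      open ≤-Reasoning
      l : Fin n → ℕ
      l u = 𝟙 (Q? u)
      x : Fin n → Fin n → ℕ
      x u v = 𝟙 (edge? u v)

-- Color classes and recolorings.

∑-∣colorClass∣ : (c : Coloring n k) → ∑[ i < k ] ∣ colorClass c i ∣ ≡ n
∑-∣colorClass∣ {n} {k} c = begin
  ∑[ i < k ] ∣ colorClass c i ∣       ≡⟨ sum-cong-≗ (λ i → ∣tabulate∣ (λ v → c v ≟ i)) ⟩
  -- Double counting: the pairs of a vertex and its color are now grouped by vertex, and each vertex
  -- has exactly one color.
  ∑[ i < k ] ∑[ v < n ] 𝟙 (c v ≟ i)   ≡⟨ ∑-comm (λ i v → 𝟙 (c v ≟ i)) ⟩
  ∑[ v < n ] ∑[ i < k ] 𝟙 (c v ≟ i)   ≡⟨ sum-cong-≗ (λ v → ∑-𝟙-≟ (c v)) ⟩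
  ∑[ v < n ] 1                        ≡⟨ ∑-const n 1 ⟩
  n * 1                               ≡⟨ *-identityʳ n ⟩
  n                                   ∎
  where open ≡-Reasoning

∈-colorClass⁺ : (c : Coloring n k) → ∀ {v i} → c v ≡ i → v ∈ colorClass c i
∈-colorClass⁺ c {v} {i} cv≡i =
  lookup⇒[]= v _ (trans (lookup∘tabulate _ v) (dec-true (c v ≟ i) cv≡i))

∈-colorClass⁻ : (c : Coloring n k) → ∀ {v i} → v ∈ colorClass c i → c v ≡ i
∈-colorClass⁻ c {v} {i} v∈
  with c v ≟ i | trans (sym (lookup∘tabulate (λ w → does (c w ≟ i)) v)) ([]=⇒lookup v∈)
... | yes cv≡i | _  = cv≡i
... | no _     | ()

last⊎inject₁ : (j : Fin (suc k)) → j ≡ fromℕ k ⊎ ∃ λ i → j ≡ inject₁ i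
last⊎inject₁ j with view j
... | ‵fromℕ     = inj₁ refl
... | ‵inject₁ i = inj₂ (i , refl)

-- If both ends had colors `inject₁ i` and `inject₁ j`, then `c′` would keep them, so `i` would
-- equal `j` and the edge would already conflict in `c`.
conflict⇒last : (G : Graph n) (c : Coloring n (suc k)) (c′ : Coloring n k) →
  Legal G c → ℛ c c′ → ∀ u v → Graph.Adj G u v → Monochromatic c′ (u , v) →
  c u ≡ lastColor k ⊎ c v ≡ lastColor k
conflict⇒last G c c′ legal c′∈ℛ u v uv c′u≡c′v
  with last⊎inject₁ (c u) | last⊎inject₁ (c v)
... | inj₁ cu≡last    | _               = inj₁ cu≡last
... | inj₂ _          | inj₁ cv≡last    = inj₂ cv≡last
... | inj₂ (i , cu≡i) | inj₂ (j , cv≡j) = contradiction cu≡cv (legal u v uv)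
  where
  kept : ∀ {w l} → c w ≡ inject₁ l → c′ w ≡ l
  kept {l = l} cw≡l = ∈-colorClass⁻ c′ (proj₁ (c′∈ℛ l) (∈-colorClass⁺ c cw≡l))
  i≡j : i ≡ j
  i≡j = trans (sym (kept cu≡i)) (trans c′u≡c′v (kept cv≡j))
  cu≡cv : c u ≡ c v
  cu≡cv = trans cu≡i (trans (cong inject₁ i≡j) (sym cv≡j))

-- `_/_` reduces fractions to lowest terms, which hides the given numerator and denominator. The
-- comparison is therefore made on unnormalised fractions, where it is cross-multiplication, and
-- carried back.
/-mono-≤ : ∀ a b d → a * suc d ≤ b → (+ a) / 1 ≤ℚ (+ b) / suc d
/-mono-≤ a b d ad≤b = toℚᵘ-cancel-≤
  (ℚᵘ.≤-respˡ-≃ (ℚᵘ.≃-sym (toℚᵘ-fromℚᵘ (mkℚᵘ (+ a) 0)))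
    (ℚᵘ.≤-respʳ-≃ (ℚᵘ.≃-sym (toℚᵘ-fromℚᵘ (mkℚᵘ (+ b) d))) unnormalised))
  where
  -- `mkℚᵘ` stores the denominator minus one: `0` and `d` stand for 1 and `suc d`.
  unnormalised : mkℚᵘ (+ a) 0 ≤ᵘ mkℚᵘ (+ b) d
  unnormalised = *≤* (begin
      + a ℤ.* + suc d  ≡⟨ ℤ.pos-* a (suc d) ⟨
      + (a * suc d)    ≤⟨ +≤+ ad≤b ⟩
      + b              ≡⟨ ℤ.*-identityʳ (+ b) ⟨
      + b ℤ.* + 1      ∎)
    where open ℤ.≤-Reasoning

proposition1 : ∀ (n : ℕ) (G : Graph n) (k : ℕ) .{{_ : NonZero k}}
    (c : Coloring n (suc k)) →
    Legal G c →
    (∀ (i : Fin (suc k)) → ∣ colorClass c (lastColor k) ∣ ≤ ∣ colorClass c i ∣) →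
    ∀ (c′ : Coloring n k) → ℛ c c′ →
    (+ ρ G c′) / 1 ≤ℚ (+ (n * Graph.maxDegree G)) / suc k
proposition1 n G k c legal smallest c′ c′∈ℛ = /-mono-≤ (ρ G c′) (n * Δ) k (begin
  -- The cover is `L`: for the test `c v ≟ lastColor k`, the tabulated subset is
  -- `colorClass c (lastColor k)` by definition.
  ρ G c′ * suc k       ≤⟨ *-monoˡ-≤ (suc k) (length-filter-edges≤cover*maxDegree G
                            (monochromatic? c′) (λ v → c v ≟ lastColor k)
                            (conflict⇒last G c c′ legal c′∈ℛ)) ⟩
  ∣ L ∣ * Δ * suc k    ≡⟨ *-comm (∣ L ∣ * Δ) (suc k) ⟩
  suc k * (∣ L ∣ * Δ)  ≡⟨ *-assoc (suc k) ∣ L ∣ Δ ⟨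
  suc k * ∣ L ∣ * Δ    ≤⟨ *-monoˡ-≤ Δ [1+k]∣L∣≤n ⟩
  n * Δ                ∎)
  where
  open ≤-Reasoning
  Δ = Graph.maxDegree G
  L = colorClass c (lastColor k)
  -- The least class size is at most the average one, and the `suc k` classes partition the `n`
  -- vertices.
  [1+k]∣L∣≤n : suc k * ∣ L ∣ ≤ n
  [1+k]∣L∣≤n = begin
    suc k * ∣ L ∣                      ≡⟨ ∑-const (suc k) ∣ L ∣ ⟨
    ∑[ _ < suc k ] ∣ L ∣               ≤⟨ ∑-mono-≤ smallest ⟩
    ∑[ i < suc k ] ∣ colorClass c i ∣  ≡⟨ ∑-∣colorClass∣ c ⟩
    n                                  ∎
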